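{- Let $L$ be an abelian number field of degree $n$ with Galois group $G=\mathrm{Gal}(L/\mathbb{Q})=\{g_1,\ldots,g_n\}$, ring of integers $\mathcal{O}$, and integral basis $\{\beta_1,\ldots,\beta_n\}$ of $\mathcal{O}$. Let $\alpha'\in L$ be such that $L=\mathbb{Q}[G]\alpha'$ and $\mathcal{O}\subseteq\mathbb{Z}[G]\alpha'$, and let $I=\sum_{j=1}^n\mathbb{Z}[G]b_j$ be the associated ideal of $\mathbb{Z}[G]$, where $b_j\in\mathbb{Z}[G]$ is the element with $\beta_j=b_j\alpha'$. Then $L$ has a normal integral basis if and only if $I$ is principal. More precisely: (1) If $\theta$ is a normal integral basis generator of $L$, and $\theta=t\alpha'$ with $t\in\mathbb{Z}[G]$, then $I=\mathbb{Z}[G]t$. (2) If $I$ is principal and $t\in\mathbb{Z}[G]$ is a generator of $I$, then $t\alpha'$ is a normal integral basis generator of $L$.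
   Context: An abelian number field is a finite Galois extension $L$ of $\mathbb{Q}$ with abelian Galois group $G$. The group rings $\mathbb{Q}[G]$ and $\mathbb{Z}[G]$ act on $L$ by $\left(\sum_{g\in G}a_g g\right)x=\sum_{g\in G}a_g\,g(x)$. An integral basis is a basis of $\mathcal{O}$ as a $\mathbb{Z}$-module. The field $L$ has a normal integral basis if there exists $\theta\in\mathcal{O}$ whose conjugates $g_1(\theta),\ldots,g_n(\theta)$ form a basis of $\mathcal{O}$ as a $\mathbb{Z}$-module; such a $\theta$ is called a normal integral basis generator. Given $\alpha'\in L$ with $L=\mathbb{Q}[G]\alpha'$ (so the elements $g_i(\alpha')$ form a $\mathbb{Q}$-basis of $L$) and $\mathcal{O}\subseteq\mathbb{Z}[G]\alpha'$, one can write uniquely $\beta_j=\sum_{i=1}^n b_{ij}\,g_i(\alpha')$ with $b_{ij}\in\mathbb{Z}$, for $j=1,\ldots,n$; set $b_j=\sum_{i=1}^n b_{ij}g_i\in\mathbb{Z}[G]$, so that $\beta_j=b_j\alpha'$. The ideal $I$ is the ideal of $\mathbb{Z}[G]$ generated by $b_1,\ldots,b_n$. -}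

module Defs where

open import Level using (Level; _⊔_; suc; 0ℓ)
open import Algebra.Bundles using (CommutativeRing; Group)
open import Algebra.Apartness.Bundles using (HeytingField; HeytingCommutativeRing)
open import Algebra.Definitions using (Commutative)
open import Algebra.Morphism.Structures using (module RingMorphisms)
import Algebra.Morphism.Construct.Composition as Compose
import Algebra.Morphism.Construct.Identity as Identity
import Algebra.Properties.Semiring.Exp as Exp
import Algebra.Properties.Semiring.Sum as Sum
open import Data.Fin.Base using (Fin; toℕ)
open import Data.Integer.Base using (ℤ)
import Data.Integer.Properties as ℤ
open import Data.Nat.Base using (ℕ)
open import Data.Product.Base using (∃; _×_; _,_; proj₁; proj₂)
open import Data.Rational.Base as ℚ using (ℚ)
import Data.Rational.Properties as ℚ
open import Data.Vec.Functional using (Vector)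
open import Function.Bundles using (Inverse)
import Relation.Binary.PropositionalEquality.Properties as ≡
open import Relation.Unary using (Pred; U; _≐_; _∈_)

private variable
  c ℓ ℓ₁ ℓ₂ r s p : Level

------------------------------------------------------------------------
-- Linear combinations

-- S is regarded as an R-module through φ : R → S (always a ring
-- homomorphism below).
module Linear (R : CommutativeRing r s) (S : CommutativeRing c ℓ)
              (φ : CommutativeRing.Carrier R → CommutativeRing.Carrier S) where
  private
    module R = CommutativeRing R
  open CommutativeRing S
  open Sum semiring using (sum-syntax)

  combination : ∀ {n} → Vector R.Carrier n → Vector Carrier n → Carrier
  combination {n} a v = ∑[ i < n ] (φ (a i) * v i)

  Span : ∀ {n} → Vector Carrier n → Pred Carrier (r ⊔ ℓ)
  Span v x = ∃ λ a → x ≈ combination a v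

  Independent : ∀ {n} → Vector Carrier n → Set (r ⊔ s ⊔ ℓ)
  Independent v = ∀ a → combination a v ≈ 0# → ∀ i → a i R.≈ R.0#

  -- v is a basis of the R-submodule M of S.  The equality M ≐ Span v
  -- includes that every v i lies in M.
  IsBasis : ∀ {n} → Pred Carrier p → Vector Carrier n → Set (c ⊔ ℓ ⊔ r ⊔ s ⊔ p)
  IsBasis M v = M ≐ Span v × Independent v

------------------------------------------------------------------------
-- Number fields

record NumberField c ℓ₁ ℓ₂ : Set (suc (c ⊔ ℓ₁ ⊔ ℓ₂)) where
  field
    heytingField : HeytingField c ℓ₁ ℓ₂

  commutativeRing : CommutativeRing c ℓ₁
  commutativeRing = HeytingCommutativeRing.commutativeRing
                      (HeytingField.heytingCommutativeRing heytingField)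

  open CommutativeRing commutativeRing public

  field
    ι                    : ℚ → Carrier
    ι-isRingHomomorphism : RingMorphisms.IsRingHomomorphism ℚ.+-*-rawRing rawRing ι

  module ℚ-Linear = Linear ℚ.+-*-commutativeRing commutativeRing ι

  field
    degree   : ℕ
    hasBasis : ∃ λ (v : Vector Carrier degree) → ℚ-Linear.IsBasis U v

  ιℤ : ℤ → Carrier
  ιℤ m = ι (m ℚ./ 1)

  module ℤ-Linear = Linear ℤ.+-*-commutativeRing commutativeRing ιℤ

  open Sum semiring using (sum-syntax)
  open Exp semiring using (_^_)

  -- The ring of integers: the roots of the monic polynomials
  -- X^d + a_{d-1} X^{d-1} + ... + a_0 over ℤ.
  𝓞 : Pred Carrier ℓ₁
  𝓞 x = ∃ λ d → ∃ λ (a : Vector ℤ d) →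
          x ^ d + ∑[ i < d ] (ιℤ (a i) * x ^ toℕ i) ≈ 0#

  IsIntegralBasis : Vector Carrier degree → Set (c ⊔ ℓ₁)
  IsIntegralBasis = ℤ-Linear.IsBasis 𝓞

  record Automorphism : Set (c ⊔ ℓ₁) where
    field
      ⟦_⟧               : Carrier → Carrier
      isRingIsomorphism : RingMorphisms.IsRingIsomorphism rawRing rawRing ⟦_⟧
      fixes-ℚ           : ∀ q → ⟦ ι q ⟧ ≈ ι q

    open RingMorphisms.IsRingIsomorphism isRingIsomorphism public

  open Automorphism using (⟦_⟧)

  private
    identity : Automorphism
    identity = record
      { ⟦_⟧               = λ x → x
      ; isRingIsomorphism = Identity.isRingIsomorphism rawRing refl
      ; fixes-ℚ           = λ _ → refl
      }

    _∘_ : Automorphism → Automorphism → Automorphism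
    σ ∘ τ = record
      { ⟦_⟧               = λ x → ⟦ σ ⟧ (⟦ τ ⟧ x)
      ; isRingIsomorphism = Compose.isRingIsomorphism trans τ.isRingIsomorphism σ.isRingIsomorphism
      ; fixes-ℚ           = λ q → trans (σ.⟦⟧-cong (τ.fixes-ℚ q)) (σ.fixes-ℚ q)
      }
      where
      module σ = Automorphism σ
      module τ = Automorphism τ

    module Inv (σ : Automorphism) where
      open Automorphism σ hiding (⟦_⟧)

      inv : Carrier → Carrier
      inv y = proj₁ (surjective y)

      right : ∀ y → ⟦ σ ⟧ (inv y) ≈ y
      right y = proj₂ (surjective y) refl

      -- z is the preimage of y as soon as σ z ≈ y.
      unique : ∀ {y z} → ⟦ σ ⟧ z ≈ y → inv y ≈ z
      unique {y} σz≈y = injective (trans (right y) (sym σz≈y))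

      inverse : Automorphism
      inverse = record
        { ⟦_⟧ = inv
        ; isRingIsomorphism = record
          { isRingMonomorphism = record
            { isRingHomomorphism = record
              { isSemiringHomomorphism = record
                { isNearSemiringHomomorphism = record
                  { +-isMonoidHomomorphism = record
                    { isMagmaHomomorphism = record
                      { isRelHomomorphism = record
                        { cong = λ {x} {y} x≈y → unique (trans (right y) (sym x≈y)) }
                      ; homo = λ x y → unique
                          (trans (+-homo (inv x) (inv y)) (+-cong (right x) (right y)))
                      }
                    ; ε-homo = unique 0#-homo
                    }
                  ; *-homo = λ x y → unique
                      (trans (*-homo (inv x) (inv y)) (*-cong (right x) (right y)))
                  }
                ; 1#-homo = unique 1#-homo
                }
              ; -‿homo = λ x → unique (trans (-‿homo (inv x)) (-‿cong (right x)))
              }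
            ; injective = λ {x} {y} e →
                trans (sym (right x)) (trans (⟦⟧-cong e) (right y))
            }
          ; surjective = λ y → ⟦ σ ⟧ y , λ z≈σy → unique (sym z≈σy)
          }
        ; fixes-ℚ = λ q → unique (fixes-ℚ q)
        }

  Gal : Group (c ⊔ ℓ₁) (c ⊔ ℓ₁)
  Gal = record
    { Carrier = Automorphism
    ; _≈_     = λ σ τ → ∀ x → ⟦ σ ⟧ x ≈ ⟦ τ ⟧ x
    ; _∙_     = _∘_
    ; ε       = identity
    ; _⁻¹     = Inv.inverse
    ; isGroup = record
      { isMonoid = record
        { isSemigroup = record
          { isMagma = record
            { isEquivalence = record
              { refl  = λ _ → refl
              ; sym   = λ e x → sym (e x)
              ; trans = λ e f x → trans (e x) (f x)
              }
            ; ∙-cong = λ {σ} {σ′} {τ} {τ′} e f x →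
                trans (Automorphism.⟦⟧-cong σ (f x)) (e (⟦ τ′ ⟧ x))
            }
          ; assoc = λ _ _ _ _ → refl
          }
        ; identity = (λ _ _ → refl) , (λ _ _ → refl)
        }
      ; inverse = (λ σ x → Inv.unique σ refl) , (λ σ x → Inv.right σ x)
      ; ⁻¹-cong = λ {σ} {τ} e x →
          Inv.unique σ (trans (e (Inv.inv τ x)) (Inv.right τ x))
      }
    }

  -- The fixed field of the automorphism group of the (finite) extension is ℚ.
  IsGalois : Set (c ⊔ ℓ₁)
  IsGalois = ∀ x → (∀ σ → ⟦ σ ⟧ x ≈ x) → ∃ λ q → x ≈ ι q

record AbelianNumberField c ℓ₁ ℓ₂ : Set (suc (c ⊔ ℓ₁ ⊔ ℓ₂)) where
  field
    numberField : NumberField c ℓ₁ ℓ₂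

  open NumberField numberField public

  field
    isGalois    : IsGalois
    Gal-abelian : Commutative (Group._≈_ Gal) (Group._∙_ Gal)

------------------------------------------------------------------------
-- Group rings of finite groups

-- A listing g₁, …, gₙ of the elements of G, without repetition.
Enumeration : Group c ℓ → ℕ → Set (c ⊔ ℓ)
Enumeration G n = Inverse (≡.setoid (Fin n)) (Group.setoid G)

module GroupRing (R : CommutativeRing r s) (G : Group c ℓ)
                 {n : ℕ} (g : Enumeration G n) where
  private
    module R = CommutativeRing R
    module S = Sum R.semiring
  open Group G using (_∙_; _⁻¹)
  open Inverse g using () renaming (to to elem; from to index)

  -- The vector a stands for Σᵢ aᵢ gᵢ.
  R[G] : Set r
  R[G] = Vector R.Carrier n

  infix  4 _≈_
  infixl 7 _*_

  _≈_ : R[G] → R[G] → Set s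
  a ≈ b = ∀ k → a k R.≈ b k

  -- The terms of (Σᵢ aᵢ gᵢ)(Σⱼ bⱼ gⱼ) contributing to gₖ are those with
  -- gⱼ = gᵢ⁻¹ gₖ.
  _*_ : R[G] → R[G] → R[G]
  (a * b) k = S.sum {n} λ i → a i R.* b (index (elem i ⁻¹ ∙ elem k))

  sum : ∀ {m} → Vector R[G] m → R[G]
  sum x k = S.sum λ j → x j k

  -- R[G] x₁ + … + R[G] xₘ
  Ideal⟨_⟩ : ∀ {m} → Vector R[G] m → Pred R[G] (r ⊔ s)
  Ideal⟨_⟩ {m} x y = ∃ λ (a : Vector R[G] m) → y ≈ sum λ j → a j * x j

  R[G]·_ : R[G] → Pred R[G] (r ⊔ s)
  (R[G]· t) y = ∃ λ a → y ≈ a * t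

  IsPrincipal : Pred R[G] p → Set (r ⊔ s ⊔ p)
  IsPrincipal I = ∃ λ t → I ≐ R[G]· t

------------------------------------------------------------------------
-- Galois modules

module GaloisModule (L : NumberField c ℓ₁ ℓ₂)
    (g : Enumeration (NumberField.Gal L) (NumberField.degree L)) where
  open NumberField L

  module ℚ[G] = GroupRing ℚ.+-*-commutativeRing Gal g renaming (R[G] to Carrier)
  module ℤ[G] = GroupRing ℤ.+-*-commutativeRing Gal g renaming (R[G] to Carrier)

  conjugates : Carrier → Vector Carrier degree
  conjugates x i = Automorphism.⟦_⟧ (Inverse.to g i) x

  infixr 8 _•ℚ_ _•ℤ_

  _•ℚ_ : ℚ[G].Carrier → Carrier → Carrier
  a •ℚ x = ℚ-Linear.combination a (conjugates x)

  _•ℤ_ : ℤ[G].Carrier → Carrier → Carrier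
  a •ℤ x = ℤ-Linear.combination a (conjugates x)

  IsNormalIntegralBasisGenerator : Carrier → Set (c ⊔ ℓ₁)
  IsNormalIntegralBasisGenerator θ = θ ∈ 𝓞 × IsIntegralBasis (conjugates θ)

  HasNormalIntegralBasis : Set (c ⊔ ℓ₁)
  HasNormalIntegralBasis = ∃ IsNormalIntegralBasisGenerator

{-# OPTIONS --safe #-}

-- Since L = ℚ[G]α′ has dimension n, the n conjugates of α′ are independent, so
-- y ↦ yα′ is injective on ℤ[G].  Under this embedding I corresponds to 𝓞
-- (y ∈ I iff yα′ ∈ 𝓞, as 𝓞 is a ℤ[G]-module spanned by the bⱼα′), and ℤ[G]t
-- corresponds to the ℤ-span of the conjugates of tα′.  Hence I = ℤ[G]t iff these
-- conjugates span 𝓞, and n vectors spanning a module of rank n over a domain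
-- are independent.

module Submission where

open import Defs
open import Algebra.Bundles using (CommutativeRing; Group; Monoid)
open import Algebra.Morphism.Structures using (module RingMorphisms; module MonoidMorphisms)
import Algebra.Morphism.Construct.Composition as Compose
import Algebra.Properties.Group as GroupProperties
import Algebra.Properties.Monoid.Sum as MonoidSum
import Algebra.Properties.Ring as RingProperties
import Algebra.Properties.Semiring.Exp as Exp
import Algebra.Properties.Semiring.Sum as Sum
import Algebra.Solver.Ring.NaturalCoefficients.Default as NaturalCoefficients
open import Data.Fin.Base using (Fin; zero; suc; punchIn; toℕ)
open import Data.Fin.Permutation as Permutation using (Permutation; permutation)
open import Data.Fin.Properties using (any?)
open import Data.Integer.Base as ℤ using (ℤ; +_; +[1+_]; -[1+_])
import Data.Integer.Properties as ℤ
open import Data.Nat.Base using (ℕ; zero; suc)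
import Data.Nat.Coprimality as ℕ
open import Data.Product.Base using (∃; _×_; _,_; proj₁; proj₂)
open import Data.Rational.Base as ℚ using (ℚ)
import Data.Rational.Properties as ℚ
open import Data.Sum.Base using (_⊎_; inj₁; inj₂; [_,_]′)
open import Data.Vec.Functional using (Vector; insertAt; removeAt; tail; _∷_)
open import Data.Vec.Functional.Properties using (insertAt-lookup; insertAt-punchIn)
open import Function.Base using (_∘_)
open import Function.Bundles using (_⇔_; mk⇔; Inverse)
open import Level using (Level)
open import Relation.Binary.Definitions using (Decidable)
open import Relation.Binary.PropositionalEquality as ≡ using (_≡_)
import Relation.Binary.Reasoning.Setoid as SetoidReasoning
open import Relation.Nullary using (¬_; yes; no)
open import Relation.Nullary.Decidable using (¬?; decidable-stable)
open import Relation.Unary using (_∈_; _≐_; _⊆_)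

private variable
  c ℓ ℓ₁ ℓ₂ r s : Level

-- Finite sums under monoid homomorphisms.

module _ (M : Monoid r s) (N : Monoid c ℓ) where
  private
    module M = Monoid M
    module N = Monoid N

  sum-homo : ∀ {f} → MonoidMorphisms.IsMonoidHomomorphism M.rawMonoid N.rawMonoid f →
             ∀ {n} (v : Vector M.Carrier n) →
             f (MonoidSum.sum M v) N.≈ MonoidSum.sum N (f ∘ v)
  sum-homo h {zero}  v = MonoidMorphisms.IsMonoidHomomorphism.ε-homo h
  sum-homo h {suc n} v =
    N.trans (MonoidMorphisms.IsMonoidHomomorphism.homo h _ _)
            (N.∙-congˡ (sum-homo h (v ∘ suc)))

-- Linear combinations and spans over a base ring.

module LinearProperties
    (R : CommutativeRing r s) (S : CommutativeRing c ℓ)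
    {φ : CommutativeRing.Carrier R → CommutativeRing.Carrier S}
    (φ-hom : RingMorphisms.IsRingHomomorphism
               (CommutativeRing.rawRing R) (CommutativeRing.rawRing S) φ) where
  private
    module R = CommutativeRing R
    module φ = RingMorphisms.IsRingHomomorphism φ-hom
    module RΣ = Sum R.semiring
  open CommutativeRing S hiding (zero)
  open Sum semiring
  open Linear R S φ
  open SetoidReasoning setoid
  open NaturalCoefficients commutativeSemiring

  combination-cong : ∀ {n} {a b : Vector R.Carrier n} {v w : Vector Carrier n} →
                     (∀ i → a i R.≈ b i) → (∀ i → v i ≈ w i) →
                     combination a v ≈ combination b w
  combination-cong a≈b v≈w = sum-cong-≋ λ i → *-cong (φ.⟦⟧-cong (a≈b i)) (v≈w i)

  combination-congʳ : ∀ {n} {a b : Vector R.Carrier n} {v : Vector Carrier n} →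
                      (∀ i → a i R.≈ b i) → combination a v ≈ combination b v
  combination-congʳ a≈b = combination-cong a≈b λ _ → refl

  combination-congˡ : ∀ {n} {a : Vector R.Carrier n} {v w : Vector Carrier n} →
                      (∀ i → v i ≈ w i) → combination a v ≈ combination a w
  combination-congˡ = combination-cong λ _ → R.refl

  combination-+ : ∀ {n} (a b : Vector R.Carrier n) (v : Vector Carrier n) →
                  combination (λ i → a i R.+ b i) v ≈ combination a v + combination b v
  combination-+ {n} a b v = begin
    combination (λ i → a i R.+ b i) v
      ≈⟨ sum-cong-≋ {n} (λ i → trans (*-congʳ (φ.+-homo _ _)) (distribʳ _ _ _)) ⟩
    ∑[ i < _ ] (φ (a i) * v i + φ (b i) * v i)
      ≈⟨ ∑-distrib-+ (λ i → φ (a i) * v i) (λ i → φ (b i) * v i) ⟩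
    combination a v + combination b v ∎

  combination-* : ∀ {n} x (a : Vector R.Carrier n) (v : Vector Carrier n) →
                  combination (λ i → x R.* a i) v ≈ φ x * combination a v
  combination-* {n} x a v = begin
    combination (λ i → x R.* a i) v
      ≈⟨ sum-cong-≋ {n} (λ i → trans (*-congʳ (φ.*-homo _ _)) (*-assoc _ _ _)) ⟩
    ∑[ i < _ ] (φ x * (φ (a i) * v i))
      ≈⟨ *-distribˡ-sum (φ x) (λ i → φ (a i) * v i) ⟨
    φ x * combination a v ∎

  combination-0 : ∀ {n} (v : Vector Carrier n) → combination (λ _ → R.0#) v ≈ 0#
  combination-0 {n} v = trans
    (sum-cong-≋ {n} λ _ → trans (*-congʳ φ.0#-homo) (zeroˡ _))
    (sum-replicate-zero n)

  -- Interchange of two finite sums. It serves both sums of group ring elements and their products,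
  -- whose coefficients are themselves sums.
  combination-sum : ∀ {m n} (a : Fin m → Vector R.Carrier n) (v : Vector Carrier n) →
                    combination (λ k → RΣ.sum λ j → a j k) v ≈
                    ∑[ j < m ] combination (a j) v
  combination-sum {n = n} a v = begin
    combination (λ k → RΣ.sum λ j → a j k) v
      ≈⟨ sum-cong-≋ {n} (λ k → trans
           (*-congʳ (sum-homo R.+-monoid +-monoid φ.+-isMonoidHomomorphism (λ j → a j k)))
           (*-distribʳ-sum (v k) (λ j → φ (a j k)))) ⟩
    ∑[ k < _ ] ∑[ j < _ ] (φ (a j k) * v k)
      ≈⟨ ∑-comm (λ k j → φ (a j k) * v k) ⟩
    ∑[ j < _ ] combination (a j) v ∎

  -- Defined by recursion on the index, so that `combination-δ` follows the recursion of `sum` and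
  -- no equality of indices has to be decided.
  δ : ∀ {n} → Fin n → Vector R.Carrier n
  δ zero    = R.1# ∷ λ _ → R.0#
  δ (suc k) = R.0# ∷ δ k

  combination-δ : ∀ {n} (k : Fin n) (v : Vector Carrier n) → combination (δ k) v ≈ v k
  combination-δ zero v = trans
    (+-cong (trans (*-congʳ φ.1#-homo) (*-identityˡ _)) (combination-0 (tail v)))
    (+-identityʳ _)
  combination-δ (suc k) v = trans
    (+-cong (trans (*-congʳ φ.0#-homo) (zeroˡ _)) (combination-δ k (tail v)))
    (+-identityˡ _)

  ∈-Span : ∀ {n} (v : Vector Carrier n) k → v k ∈ Span v
  ∈-Span v k = δ k , sym (combination-δ k v)

  Span-resp-≈ : ∀ {n} {v : Vector Carrier n} {x y} → x ≈ y → x ∈ Span v → y ∈ Span v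
  Span-resp-≈ x≈y (a , x≈) = a , trans (sym x≈y) x≈

  Span-sum : ∀ {m n} {v : Vector Carrier n} (w : Vector Carrier m) →
             (∀ j → w j ∈ Span v) → sum w ∈ Span v
  Span-sum {v = v} w w∈ = _ , trans (sum-cong-≋ (proj₂ ∘ w∈))
                                    (sym (combination-sum (proj₁ ∘ w∈) v))

  Span-combination : ∀ {m n} {v : Vector Carrier n} (a : Vector R.Carrier m) {w} →
                     (∀ j → w j ∈ Span v) → combination a w ∈ Span v
  Span-combination {v = v} a w∈ = Span-sum _ λ j →
    (λ i → a j R.* proj₁ (w∈ j) i) ,
    trans (*-congˡ (proj₂ (w∈ j))) (sym (combination-* (a j) (proj₁ (w∈ j)) v))

  -- Gaussian elimination without division: `b k · a − a k · b` has coordinate zero at `k`, and only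
  -- its other coordinates are kept.
  eliminate : ∀ {n} → Fin (suc n) → (a b : Vector R.Carrier (suc n)) → Vector R.Carrier n
  eliminate k a b j = b k R.* a (punchIn k j) R.+ (R.- a k) R.* b (punchIn k j)

  -- The coefficient of v k cancels on the right.
  combination-eliminate : ∀ {n} k (a b : Vector R.Carrier (suc n)) (v : Vector Carrier (suc n)) →
    combination (eliminate k a b) (removeAt v k) ≈
    φ (b k) * combination a v + (- φ (a k)) * combination b v
  combination-eliminate k a b v = begin
    combination (eliminate k a b) v′
      ≈⟨ combination-+ (λ j → b k R.* a′ j) (λ j → (R.- a k) R.* b′ j) v′ ⟩
    combination (λ j → b k R.* a′ j) v′ + combination (λ j → (R.- a k) R.* b′ j) v′
      ≈⟨ +-cong (combination-* (b k) a′ v′)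
                (trans (combination-* (R.- a k) b′ v′) (*-congʳ (φ.-‿homo (a k)))) ⟩
    φ (b k) * combination a′ v′ + (- φ (a k)) * combination b′ v′
      ≈⟨ cancel (φ (a k)) (φ (b k)) (v k) _ _ ⟩
    φ (b k) * (φ (a k) * v k + combination a′ v′) +
      (- φ (a k)) * (φ (b k) * v k + combination b′ v′)
      ≈⟨ +-cong (*-congˡ (sum-remove (λ i → φ (a i) * v i)))
                (*-congˡ (sum-remove (λ i → φ (b i) * v i))) ⟨
    φ (b k) * combination a v + (- φ (a k)) * combination b v ∎
    where
    a′ = removeAt a k
    b′ = removeAt b k
    v′ = removeAt v k
    cancel : ∀ x y z s t → y * s + (- x) * t ≈ y * (x * z + s) + (- x) * (y * z + t)
    cancel x y z s t = begin
      y * s + (- x) * t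
        ≈⟨ +-identityʳ _ ⟨
      y * s + (- x) * t + 0#
        -- The solver works in commutative semirings and treats `- x` as an independent variable, so
        -- the cancelling terms are put in by hand as a multiple of `x - x`.
        ≈⟨ +-congˡ (trans (*-congʳ (-‿inverseʳ x)) (zeroˡ _)) ⟨
      y * s + (- x) * t + (x - x) * (y * z)
        ≈⟨ solve 6 (λ x x′ y z s t →
             y :* s :+ x′ :* t :+ (x :+ x′) :* (y :* z) :=
             y :* (x :* z :+ s) :+ x′ :* (y :* z :+ t)) refl x (- x) y z s t ⟩
      y * (x * z + s) + (- x) * (y * z + t) ∎

  -- Linear dependence over a domain with decidable equality.

  module _ (_≟_ : Decidable R._≈_) (1≉0 : ¬ R.1# R.≈ R.0#)
           (zero-product : ∀ {x y} → x R.* y R.≈ R.0# → x R.≈ R.0# ⊎ y R.≈ R.0#) where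

    -- Induction on the number of spanning vectors. If the first `w` has coefficient zero in every
    -- `v i`, it is dropped together with the first `v`. Otherwise some `v k` with nonzero
    -- coefficient is the pivot: cleared of the first `w`, the other `v i` lie in the span of
    -- `tail w`. The absence of zero divisors keeps the resulting relation nontrivial.
    dependent : ∀ {n} (v : Vector Carrier (suc n)) (w : Vector Carrier n) →
                (∀ i → v i ∈ Span w) →
                ∃ λ x → combination x v ≈ 0# × ∃ λ i → ¬ x i R.≈ R.0#
    -- The only vector lies in the span of the empty family, hence is zero, and the coefficient 1
    -- gives a relation.
    dependent {zero} v w v∈ = (λ _ → R.1#) , vanishes , zero , 1≉0
      where
      vanishes : combination {1} (λ _ → R.1#) v ≈ 0#
      vanishes = trans (+-identityʳ _) (trans (*-congˡ (proj₂ (v∈ zero))) (zeroʳ _))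
    dependent {suc n} v w v∈ with any? (λ i → ¬? (proj₁ (v∈ i) zero ≟ R.0#))
    ... | no none =
      let x , x·v≈0 , i , xᵢ≉0 = dependent (tail v) (tail w) λ i → tail (proj₁ (v∈ (suc i))) , (begin
            v (suc i)
              ≈⟨ proj₂ (v∈ (suc i)) ⟩
            combination (proj₁ (v∈ (suc i))) w
              ≈⟨ +-congʳ (trans (*-congʳ (trans (φ.⟦⟧-cong (head≈0 (suc i))) φ.0#-homo)) (zeroˡ _)) ⟩
            0# + combination (tail (proj₁ (v∈ (suc i)))) (tail w)
              ≈⟨ +-identityˡ _ ⟩
            combination (tail (proj₁ (v∈ (suc i)))) (tail w) ∎)
      in (R.0# ∷ x) ,
         trans (+-cong (trans (*-congʳ φ.0#-homo) (zeroˡ _)) x·v≈0) (+-identityˡ _) ,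
         suc i , xᵢ≉0
      where
      head≈0 : ∀ i → proj₁ (v∈ i) zero R.≈ R.0#
      head≈0 i = decidable-stable (proj₁ (v∈ i) zero ≟ R.0#) λ ≉0 → none (i , ≉0)
    ... | yes (k , d≉0) = y , y·v≈0 , punchIn k i , yᵢ≉0
      where
      A : ∀ i → Vector R.Carrier (suc n)
      A i = proj₁ (v∈ i)
      d = A k zero
      e : Vector R.Carrier (suc n)
      e i = A (punchIn k i) zero
      -- Along the first `w`, the vectors `v (punchIn k i)` and `v k` have coefficients `e i` and
      -- `d`, which cancel in `v′ i`.
      v′ : Vector Carrier (suc n)
      v′ i = φ d * v (punchIn k i) + (- φ (e i)) * v k
      IH = dependent v′ (tail w) λ i → eliminate zero (A (punchIn k i)) (A k) , trans
             (+-cong (*-congˡ (proj₂ (v∈ (punchIn k i)))) (*-congˡ (proj₂ (v∈ k))))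
             (sym (combination-eliminate zero (A (punchIn k i)) (A k) w))
      x = proj₁ IH
      i = proj₁ (proj₂ (proj₂ IH))
      -- Expanding the relation `x` between the `v′ i` in terms of `v` gives `x i · d` at
      -- `punchIn k i`, and this sum at the pivot `k`.
      yₖ = RΣ.sum λ i → x i R.* (R.- e i)
      y = insertAt (λ i → x i R.* d) k yₖ
      yᵢ≡ : ∀ i → y (punchIn k i) ≡ x i R.* d
      yᵢ≡ = insertAt-punchIn (λ i → x i R.* d) k yₖ
      yᵢ≉0 : ¬ y (punchIn k i) R.≈ R.0#
      yᵢ≉0 eq = [ proj₂ (proj₂ (proj₂ IH)) , d≉0 ]′
        (zero-product (R.trans (R.reflexive (≡.sym (yᵢ≡ i))) eq))
      y·v≈0 : combination y v ≈ 0#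
      y·v≈0 = begin
        combination y v
          ≈⟨ sum-remove (λ i → φ (y i) * v i) ⟩
        φ (y k) * v k + combination (removeAt y k) (removeAt v k)
          ≈⟨ +-cong (*-congʳ (φ.⟦⟧-cong (R.reflexive (insertAt-lookup (λ i → x i R.* d) k yₖ))))
                    (combination-congʳ {v = removeAt v k} λ i → R.reflexive (yᵢ≡ i)) ⟩
        φ yₖ * v k + combination (λ i → x i R.* d) (removeAt v k)
          ≈⟨ +-congʳ (trans
               (*-congʳ (sum-homo R.+-monoid +-monoid φ.+-isMonoidHomomorphism (λ i → x i R.* (R.- e i))))
               (*-distribʳ-sum (v k) (λ i → φ (x i R.* (R.- e i))))) ⟩
        ∑[ i < _ ] (φ (x i R.* (R.- e i)) * v k) + combination (λ i → x i R.* d) (removeAt v k)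
          ≈⟨ ∑-distrib-+ (λ i → φ (x i R.* (R.- e i)) * v k) (λ i → φ (x i R.* d) * v (punchIn k i)) ⟨
        ∑[ i < _ ] (φ (x i R.* (R.- e i)) * v k + φ (x i R.* d) * v (punchIn k i))
          ≈⟨ sum-cong-≋ (λ i → trans
               (+-cong (*-congʳ (trans (φ.*-homo _ _) (*-congˡ (φ.-‿homo (e i))))) (*-congʳ (φ.*-homo _ _)))
               (solve 5 (λ x d e v u →
                 x :* e :* u :+ x :* d :* v := x :* (d :* v :+ e :* u))
                 refl (φ (x i)) (φ d) (- φ (e i)) (v (punchIn k i)) (v k))) ⟩
        combination x v′
          ≈⟨ proj₁ (proj₂ IH) ⟩
        0# ∎

    -- If c · w ≈ 0 with c k ≉ 0, the multiples c k · v i lie in the span of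
    -- the remaining w j, and are too many to be independent.
    spanning⇒independent : ∀ {n} {v w : Vector Carrier n} → Independent v →
                           (∀ i → v i ∈ Span w) → Independent w
    spanning⇒independent {suc n} {v} {w} v-indep v∈ c c·w≈0 k =
      decidable-stable (c k ≟ R.0#) λ cₖ≉0 →
        let x , x·v≈0 , i , xᵢ≉0 = dependent (λ i → φ (c k) * v i) (removeAt w k) λ i →
              eliminate k (proj₁ (v∈ i)) c , (begin
                φ (c k) * v i
                  ≈⟨ *-congˡ (proj₂ (v∈ i)) ⟩
                φ (c k) * combination (proj₁ (v∈ i)) w
                  ≈⟨ +-identityʳ _ ⟨
                φ (c k) * combination (proj₁ (v∈ i)) w + 0#
                  ≈⟨ +-congˡ (trans (*-congˡ c·w≈0) (zeroʳ _)) ⟨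
                φ (c k) * combination (proj₁ (v∈ i)) w + (- φ (proj₁ (v∈ i) k)) * combination c w
                  ≈⟨ combination-eliminate k (proj₁ (v∈ i)) c w ⟨
                combination (eliminate k (proj₁ (v∈ i)) c) (removeAt w k) ∎)
        in [ xᵢ≉0 , cₖ≉0 ]′ (zero-product (v-indep (λ i → x i R.* c k)
             (trans
               (sum-cong-≋ {suc n} {_} {λ i → φ (x i) * (φ (c k) * v i)} λ i →
                 trans (*-congʳ (φ.*-homo _ _)) (*-assoc _ _ _))
               x·v≈0) i))

-- Translations of an enumerated group.

module _ (G : Group c ℓ) {n : ℕ} (g : Enumeration G n) where
  open Group G
  open GroupProperties G using (\\-leftDividesˡ; \\-leftDividesʳ)
  open Inverse g using (strictlyInverseˡ; strictlyInverseʳ; from-cong)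
    renaming (to to elem; from to index)

  -- Stated on indices so that `sum-permute` can carry out the substitution of `elem i ∙ h` for `h`
  -- in a sum over the group.
  leftTranslation : Fin n → Permutation n n
  leftTranslation i = permutation
    (λ m → index (elem i ∙ elem m))
    (λ k → index (elem i ⁻¹ ∙ elem k))
    (λ k → ≡.trans
      (from-cong (trans (∙-congˡ (strictlyInverseˡ _)) (\\-leftDividesˡ (elem i) (elem k))))
      (strictlyInverseʳ k))
    (λ m → ≡.trans
      (from-cong (trans (∙-congˡ (strictlyInverseˡ _)) (\\-leftDividesʳ (elem i) (elem m))))
      (strictlyInverseʳ m))

-- The embedding of ℤ into ℚ, and zero products in ℚ.

-- The fraction `i / 1` is normalised by a gcd and does not reduce for a variable `i`. The explicit
-- form exposes numerator and denominator, so that the operations of ℚ compute.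
i/1≡mkℚ : ∀ i → i ℚ./ 1 ≡ ℚ.mkℚ i 0 (ℕ.sym (ℕ.1-coprimeTo _))
i/1≡mkℚ i = ℚ.↥p/↧p≡p (ℚ.mkℚ i 0 (ℕ.sym (ℕ.1-coprimeTo _)))

/1-injective : ∀ {i j} → i ℚ./ 1 ≡ j ℚ./ 1 → i ≡ j
/1-injective {i} {j} eq =
  ≡.cong ℚ.↥_ (≡.trans (≡.sym (i/1≡mkℚ i)) (≡.trans eq (i/1≡mkℚ j)))

/1-+-homo : ∀ i j → (i ℤ.+ j) ℚ./ 1 ≡ (i ℚ./ 1) ℚ.+ (j ℚ./ 1)
/1-+-homo i j rewrite i/1≡mkℚ i | i/1≡mkℚ j =
  ≡.cong (ℚ._/ 1) (≡.sym (≡.cong₂ ℤ._+_ (ℤ.*-identityʳ i) (ℤ.*-identityʳ j)))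

/1-*-homo : ∀ i j → (i ℤ.* j) ℚ./ 1 ≡ (i ℚ./ 1) ℚ.* (j ℚ./ 1)
/1-*-homo i j rewrite i/1≡mkℚ i | i/1≡mkℚ j = ≡.refl

-- The cases follow the clauses of `_/_`: a fraction with negative numerator is by definition the
-- negation of a positive one, so the last case is a double negation.
/1-neg-homo : ∀ i → (ℤ.- i) ℚ./ 1 ≡ ℚ.- (i ℚ./ 1)
/1-neg-homo (+ zero) = ≡.refl
/1-neg-homo +[1+ n ] = ≡.refl
/1-neg-homo -[1+ n ] = ≡.sym (RingProperties.-‿involutive ℚ.+-*-ring _)

/1-isRingHomomorphism : RingMorphisms.IsRingHomomorphism ℤ.+-*-rawRing ℚ.+-*-rawRing (ℚ._/ 1)
/1-isRingHomomorphism = record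
  { isSemiringHomomorphism = record
    { isNearSemiringHomomorphism = record
      { +-isMonoidHomomorphism = record
        { isMagmaHomomorphism = record
          { isRelHomomorphism = record { cong = ≡.cong (ℚ._/ 1) }
          ; homo = /1-+-homo
          }
        ; ε-homo = ≡.refl
        }
      ; *-homo = /1-*-homo
      }
    ; 1#-homo = ≡.refl
    }
  ; -‿homo = /1-neg-homo
  }

p*q≡0⇒p≡0∨q≡0 : ∀ p {q} → p ℚ.* q ≡ ℚ.0ℚ → p ≡ ℚ.0ℚ ⊎ q ≡ ℚ.0ℚ
p*q≡0⇒p≡0∨q≡0 p {q} pq≡0 with p ℚ.≟ ℚ.0ℚ
... | yes p≡0 = inj₁ p≡0
... | no  p≢0 = inj₂ (begin
  q                    ≡⟨ ℚ.*-identityˡ q ⟨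
  ℚ.1ℚ ℚ.* q           ≡⟨ ≡.cong (ℚ._* q) (ℚ.*-inverseˡ p) ⟨
  ℚ.1/ p ℚ.* p ℚ.* q   ≡⟨ ℚ.*-assoc (ℚ.1/ p) p q ⟩
  ℚ.1/ p ℚ.* (p ℚ.* q) ≡⟨ ≡.cong (ℚ.1/ p ℚ.*_) pq≡0 ⟩
  ℚ.1/ p ℚ.* ℚ.0ℚ      ≡⟨ ℚ.*-zeroʳ (ℚ.1/ p) ⟩
  ℚ.0ℚ                 ∎)
  where
  open ≡.≡-Reasoning
  instance _ = ℚ.≢-nonZero p≢0

-- Independence and integrality in a number field.

module NumberFieldProperties (L : NumberField c ℓ₁ ℓ₂) where
  open NumberField L
  open Automorphism using (⟦_⟧; ⟦⟧-cong; +-homo; *-homo; 0#-homo; 1#-homo; +-isMonoidHomomorphism)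
  open Exp semiring using (_^_)
  open SetoidReasoning setoid

  ιℤ-isRingHomomorphism : RingMorphisms.IsRingHomomorphism ℤ.+-*-rawRing rawRing ιℤ
  ιℤ-isRingHomomorphism =
    Compose.isRingHomomorphism trans /1-isRingHomomorphism ι-isRingHomomorphism

  module ℤ-Properties = LinearProperties ℤ.+-*-commutativeRing commutativeRing ιℤ-isRingHomomorphism
  module ℚ-Properties = LinearProperties ℚ.+-*-commutativeRing commutativeRing ι-isRingHomomorphism

  ℤ-spanning⇒independent : ∀ {n} {v w : Vector Carrier n} → ℤ-Linear.Independent v →
                           (∀ i → v i ∈ ℤ-Linear.Span w) → ℤ-Linear.Independent w
  ℤ-spanning⇒independent =
    ℤ-Properties.spanning⇒independent ℤ._≟_ (λ ()) (λ {i} → ℤ.i*j≡0⇒i≡0∨j≡0 i)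

  ℚ-spanning⇒independent : ∀ {n} {v w : Vector Carrier n} → ℚ-Linear.Independent v →
                           (∀ i → v i ∈ ℚ-Linear.Span w) → ℚ-Linear.Independent w
  ℚ-spanning⇒independent =
    ℚ-Properties.spanning⇒independent ℚ._≟_ (λ ()) (λ {p} → p*q≡0⇒p≡0∨q≡0 p)

  -- Since `ιℤ` factors through ℚ by definition, an integer relation is already a rational one, and
  -- its coefficients vanish in ℤ by `/1-injective`.
  ℚ-independent⇒ℤ-independent : ∀ {n} {v : Vector Carrier n} →
                                ℚ-Linear.Independent v → ℤ-Linear.Independent v
  ℚ-independent⇒ℤ-independent v-indep a a·v≈0 i =
    /1-injective (v-indep (λ i → a i ℚ./ 1) a·v≈0 i)

  ^-homo : ∀ σ x n → ⟦ σ ⟧ (x ^ n) ≈ ⟦ σ ⟧ x ^ n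
  ^-homo σ x zero    = 1#-homo σ
  ^-homo σ x (suc n) = trans (*-homo σ _ _) (*-congˡ (^-homo σ x n))

  combination-homo : ∀ σ {n} (a : Vector ℤ n) (v : Vector Carrier n) →
                     ⟦ σ ⟧ (ℤ-Linear.combination a v) ≈ ℤ-Linear.combination a (⟦ σ ⟧ ∘ v)
  combination-homo σ {n} a v = trans
    (sum-homo +-monoid +-monoid (+-isMonoidHomomorphism σ) (λ i → ιℤ (a i) * v i))
    (Sum.sum-cong-≋ semiring {n} λ i →
      trans (*-homo σ _ _) (*-congʳ (Automorphism.fixes-ℚ σ _)))

  -- Automorphisms fix the integer coefficients, so the image of `x` is a root of the same monic
  -- polynomial.
  𝓞-closed : ∀ σ {x} → x ∈ 𝓞 → ⟦ σ ⟧ x ∈ 𝓞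
  𝓞-closed σ {x} (d , a , root) = d , a , (begin
    ⟦ σ ⟧ x ^ d + ℤ-Linear.combination a (λ i → ⟦ σ ⟧ x ^ toℕ i)
      ≈⟨ +-cong (^-homo σ x d) (trans (combination-homo σ a (λ i → x ^ toℕ i))
           (ℤ-Properties.combination-congˡ {a = a} λ i → ^-homo σ x (toℕ i))) ⟨
    ⟦ σ ⟧ (x ^ d) + ⟦ σ ⟧ (ℤ-Linear.combination a (λ i → x ^ toℕ i))
      ≈⟨ +-homo σ _ _ ⟨
    ⟦ σ ⟧ (x ^ d + ℤ-Linear.combination a (λ i → x ^ toℕ i))
      ≈⟨ ⟦⟧-cong σ root ⟩
    ⟦ σ ⟧ 0#
      ≈⟨ 0#-homo σ ⟩
    0# ∎)

-- The action of ℤ[G] on the field.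

module GaloisModuleProperties (L : NumberField c ℓ₁ ℓ₂)
    (g : Enumeration (NumberField.Gal L) (NumberField.degree L)) where
  open NumberField L
  open NumberFieldProperties L
  open GaloisModule L g
  open ℤ-Linear using (combination; Span)
  open ℤ-Properties
  open Group Gal using (_∙_; ε; _⁻¹)
  open Inverse g using (strictlyInverseˡ)
    renaming (to to elem; from to index)
  open Sum semiring using (sum-syntax; sum-permute; sum-cong-≋)
  open SetoidReasoning setoid

  conjugates-cong : ∀ {x y} → x ≈ y → ∀ i → conjugates x i ≈ conjugates y i
  conjugates-cong x≈y i = Automorphism.⟦⟧-cong (elem i) x≈y

  •ℤ-cong : ∀ {a b x y} → a ℤ[G].≈ b → x ≈ y → a •ℤ x ≈ b •ℤ y
  •ℤ-cong a≈b x≈y = combination-cong a≈b (conjugates-cong x≈y)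

  1ℤ[G] : ℤ[G].Carrier
  1ℤ[G] = δ (index ε)

  •ℤ-identity : ∀ x → 1ℤ[G] •ℤ x ≈ x
  •ℤ-identity x = trans (combination-δ (index ε) (conjugates x)) (strictlyInverseˡ ε x)

  •ℤ-sum : ∀ {m} (a : Vector ℤ[G].Carrier m) x → ℤ[G].sum a •ℤ x ≈ ∑[ j < m ] (a j •ℤ x)
  •ℤ-sum a x = combination-sum a (conjugates x)

  •ℤ-scale : ∀ m (a : ℤ[G].Carrier) x → (λ k → m ℤ.* a k) •ℤ x ≈ ιℤ m * (a •ℤ x)
  •ℤ-scale m a x = combination-* m a (conjugates x)

  -- The coefficients on the left are those of the product of gᵢ and `b`. Substituting gₖ = gᵢ gₘ
  -- turns the sum into one over the `b m` and gᵢ(gₘ(x)), out of which gᵢ can be pulled because it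
  -- fixes the integers.
  •ℤ-translate : ∀ (b : ℤ[G].Carrier) x i →
                 (λ k → b (index (elem i ⁻¹ ∙ elem k))) •ℤ x ≈ conjugates (b •ℤ x) i
  •ℤ-translate b x i = begin
    ∑[ k < degree ] (ιℤ (b (index (elem i ⁻¹ ∙ elem k))) * conjugates x k)
      ≈⟨ sum-permute (λ k → ιℤ (b (index (elem i ⁻¹ ∙ elem k))) * conjugates x k)
           (leftTranslation Gal g i) ⟩
    ∑[ m < degree ] (ιℤ (b (index (elem i ⁻¹ ∙ elem (index (elem i ∙ elem m))))) *
                     conjugates x (index (elem i ∙ elem m)))
      ≈⟨ sum-cong-≋ {degree} (λ m → *-cong
           (reflexive (≡.cong (ιℤ ∘ b) (Permutation.inverseˡ (leftTranslation Gal g i))))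
           (strictlyInverseˡ (elem i ∙ elem m) x)) ⟩
    combination b (Automorphism.⟦_⟧ (elem i) ∘ conjugates x)
      ≈⟨ combination-homo (elem i) b (conjugates x) ⟨
    conjugates (b •ℤ x) i ∎

  -- The convolution product is the sum over i of `a i` times the translate of `b` by gᵢ, and
  -- `•ℤ-translate` handles each translate.
  •ℤ-assoc : ∀ a b x → (a ℤ[G].* b) •ℤ x ≈ a •ℤ b •ℤ x
  •ℤ-assoc a b x = begin
    (a ℤ[G].* b) •ℤ x
      ≈⟨ combination-sum (λ i k → a i ℤ.* b (index (elem i ⁻¹ ∙ elem k))) (conjugates x) ⟩
    ∑[ i < degree ] ((λ k → a i ℤ.* b (index (elem i ⁻¹ ∙ elem k))) •ℤ x)
      ≈⟨ sum-cong-≋ {degree} (λ i → trans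
           (•ℤ-scale (a i) (λ k → b (index (elem i ⁻¹ ∙ elem k))) x)
           (*-congˡ (•ℤ-translate b x i))) ⟩
    a •ℤ b •ℤ x ∎

  -- The conjugates of `x` span the field and are as many as the basis vectors in `hasBasis`, so
  -- they are independent over ℚ and then over ℤ. This is applied to the coefficients of `a − b`.
  spanning⇒faithful : ∀ {x} → (∀ y → ∃ λ a → y ≈ a •ℚ x) →
                      ∀ {a b} → a •ℤ x ≈ b •ℤ x → a ℤ[G].≈ b
  spanning⇒faithful {x} spanning {a} {b} ax≈bx k = ℤ.i-j≡0⇒i≡j (a k) (b k)
    (ℚ-independent⇒ℤ-independent
      (ℚ-spanning⇒independent (proj₂ (proj₂ hasBasis)) (λ i → spanning _))
      (λ i → a i ℤ.- b i)
      (begin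
        (λ i → a i ℤ.- b i) •ℤ x
          ≈⟨ combination-+ a (λ i → ℤ.- b i) (conjugates x) ⟩
        a •ℤ x + (λ i → ℤ.- b i) •ℤ x
          ≈⟨ +-congʳ ax≈bx ⟩
        b •ℤ x + (λ i → ℤ.- b i) •ℤ x
          ≈⟨ combination-+ b (λ i → ℤ.- b i) (conjugates x) ⟨
        (λ i → b i ℤ.- b i) •ℤ x
          ≈⟨ combination-congʳ {v = conjugates x} (λ i → ℤ.+-inverseʳ (b i)) ⟩
        (λ _ → ℤ.0ℤ) •ℤ x
          ≈⟨ combination-0 (conjugates x) ⟩
        0# ∎)
      k)

  -- The ideal I and the ring of integers.

  module _ {β : Vector Carrier degree} (β-basis : IsIntegralBasis β)
           {α′ : Carrier}
           (ℚ-spanning : ∀ x → ∃ λ a → x ≈ a •ℚ α′)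
           (ℤ-spanning : ∀ x → x ∈ 𝓞 → ∃ λ a → x ≈ a •ℤ α′)
           (b : Vector ℤ[G].Carrier degree) (β≈b•α′ : ∀ j → β j ≈ b j •ℤ α′) where
    private
      I = ℤ[G].Ideal⟨ b ⟩

      faithful : ∀ {x y} → x •ℤ α′ ≈ y •ℤ α′ → x ℤ[G].≈ y
      faithful = spanning⇒faithful ℚ-spanning

    𝓞⊆Spanβ : 𝓞 ⊆ Span β
    𝓞⊆Spanβ = proj₁ (proj₁ β-basis)

    Spanβ⊆𝓞 : Span β ⊆ 𝓞
    Spanβ⊆𝓞 = proj₂ (proj₁ β-basis)

    -- The integral basis identifies `𝓞` with a span, and spans respect equality.
    𝓞-resp-≈ : ∀ {x y} → x ≈ y → x ∈ 𝓞 → y ∈ 𝓞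
    𝓞-resp-≈ x≈y x∈𝓞 = Spanβ⊆𝓞 (Span-resp-≈ x≈y (𝓞⊆Spanβ x∈𝓞))

    -- Conjugates of an integer are integers by `𝓞-closed`, and closure under integer combinations
    -- is read off from the integral basis.
    •ℤ-Spanβ : ∀ a {x} → x ∈ 𝓞 → a •ℤ x ∈ Span β
    •ℤ-Spanβ a x∈𝓞 = Span-combination a λ i → 𝓞⊆Spanβ (𝓞-closed (elem i) x∈𝓞)

    -- If y is the sum of the aⱼ bⱼ, then yα′ is the sum of the aⱼ βⱼ, and each term is integral by
    -- `•ℤ-Spanβ`.
    ∈I⇒•α′∈𝓞 : ∀ {y} → y ∈ I → y •ℤ α′ ∈ 𝓞
    ∈I⇒•α′∈𝓞 {y} (a , y≈) = Spanβ⊆𝓞 (Span-resp-≈ (sym y•α′≈)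
      (Span-sum (λ j → a j •ℤ β j) λ j → •ℤ-Spanβ (a j) (Spanβ⊆𝓞 (∈-Span β j))))
      where
      y•α′≈ : y •ℤ α′ ≈ ∑[ j < degree ] (a j •ℤ β j)
      y•α′≈ = begin
        y •ℤ α′
          ≈⟨ •ℤ-cong y≈ refl ⟩
        ℤ[G].sum (λ j → a j ℤ[G].* b j) •ℤ α′
          ≈⟨ •ℤ-sum (λ j → a j ℤ[G].* b j) α′ ⟩
        ∑[ j < degree ] ((a j ℤ[G].* b j) •ℤ α′)
          ≈⟨ sum-cong-≋ {degree} (λ j → trans
               (•ℤ-assoc (a j) (b j) α′)
               (•ℤ-cong {a j} (λ _ → ≡.refl) (sym (β≈b•α′ j)))) ⟩
        ∑[ j < degree ] (a j •ℤ β j) ∎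

    -- With mⱼ the integer coordinates of yα′ in the basis β, the elements y and Σ mⱼ bⱼ act alike
    -- on α′, so they agree by faithfulness.
    •α′∈𝓞⇒∈I : ∀ y → y •ℤ α′ ∈ 𝓞 → y ∈ I
    •α′∈𝓞⇒∈I y y•α′∈𝓞 = a , faithful (begin
      y •ℤ α′
        ≈⟨ proj₂ (𝓞⊆Spanβ y•α′∈𝓞) ⟩
      combination m β
        ≈⟨ sum-cong-≋ {degree} (λ j → begin
             ιℤ (m j) * β j
               ≈⟨ *-congˡ (trans (β≈b•α′ j) (sym (•ℤ-identity _))) ⟩
             ιℤ (m j) * (1ℤ[G] •ℤ b j •ℤ α′)
               ≈⟨ •ℤ-scale (m j) 1ℤ[G] (b j •ℤ α′) ⟨
             a j •ℤ b j •ℤ α′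
               ≈⟨ •ℤ-assoc (a j) (b j) α′ ⟨
             (a j ℤ[G].* b j) •ℤ α′ ∎) ⟩
      ∑[ j < degree ] ((a j ℤ[G].* b j) •ℤ α′)
        ≈⟨ •ℤ-sum (λ j → a j ℤ[G].* b j) α′ ⟨
      ℤ[G].sum (λ j → a j ℤ[G].* b j) •ℤ α′ ∎)
      where
      m = proj₁ (𝓞⊆Spanβ y•α′∈𝓞)
      -- Membership in the ideal asks for coefficients in ℤ[G], so the integer `m j` enters as a
      -- multiple of the unit.
      a : Vector ℤ[G].Carrier degree
      a j k = m j ℤ.* 1ℤ[G] k

    -- Being in the span of the conjugates of θ means being aθ = (at)α′ for some a in ℤ[G]. So yα′
    -- is integral exactly when yα′ = (at)α′ for some a, that is, when y = at.
    generator⇒principal : ∀ {θ} t → IsNormalIntegralBasisGenerator θ → θ ≈ t •ℤ α′ →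
                          I ≐ ℤ[G].R[G]· t
    generator⇒principal {θ} t (_ , (𝓞⊆Spanθ , Spanθ⊆𝓞) , _) θ≈t•α′ =
      (λ y∈I →
        let a , y•α′≈a•θ = 𝓞⊆Spanθ (∈I⇒•α′∈𝓞 y∈I)
        in a , faithful (trans y•α′≈a•θ (a•θ≈ a))) ,
      (λ {y} (a , y≈a*t) → •α′∈𝓞⇒∈I y
        (Spanθ⊆𝓞 (a , trans (•ℤ-cong y≈a*t refl) (sym (a•θ≈ a)))))
      where
      a•θ≈ : ∀ a → a •ℤ θ ≈ (a ℤ[G].* t) •ℤ α′
      a•θ≈ a = trans (•ℤ-cong {a} (λ _ → ≡.refl) θ≈t•α′) (sym (•ℤ-assoc a t α′))

    -- An integer x is yα′ with y in I, so y = at and x = a(tα′), which puts x in the span of the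
    -- conjugates of tα′. The converse inclusion holds because every at lies in I.
    principal⇒generator : ∀ t → I ≐ ℤ[G].R[G]· t → IsNormalIntegralBasisGenerator (t •ℤ α′)
    principal⇒generator t (I⊆⟨t⟩ , ⟨t⟩⊆I) =
      -- The element tα′ is its own conjugate under the identity, hence integral.
      Span⊆𝓞 (1ℤ[G] , sym (•ℤ-identity _)) ,
      (𝓞⊆Span , Span⊆𝓞) ,
      -- The independent family β has the same length as the family of conjugates and lies in its
      -- span.
      ℤ-spanning⇒independent (proj₂ β-basis) λ j → 𝓞⊆Span (Spanβ⊆𝓞 (∈-Span β j))
      where
      𝓞⊆Span : 𝓞 ⊆ Span (conjugates (t •ℤ α′))
      𝓞⊆Span x∈𝓞 =
        let y , x≈y•α′ = ℤ-spanning _ x∈𝓞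
            a , y≈a*t  = I⊆⟨t⟩ (•α′∈𝓞⇒∈I y (𝓞-resp-≈ x≈y•α′ x∈𝓞))
        in a , trans x≈y•α′ (trans (•ℤ-cong y≈a*t refl) (•ℤ-assoc a t α′))

      Span⊆𝓞 : Span (conjugates (t •ℤ α′)) ⊆ 𝓞
      Span⊆𝓞 (a , x≈a•t•α′) = 𝓞-resp-≈ (trans (•ℤ-assoc a t α′) (sym x≈a•t•α′))
        (∈I⇒•α′∈𝓞 (⟨t⟩⊆I (a , λ _ → ≡.refl)))

theorem2p2 : ∀ {c ℓ₁ ℓ₂} (L : AbelianNumberField c ℓ₁ ℓ₂) →
    let open AbelianNumberField L in
    (g : Enumeration Gal degree) →
    let open GaloisModule numberField g in
    (β : Vector Carrier degree) → IsIntegralBasis β →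
    (α′ : Carrier) →
    (∀ x → ∃ λ a → x ≈ a •ℚ α′) →
    (∀ x → x ∈ 𝓞 → ∃ λ a → x ≈ a •ℤ α′) →
    (b : Vector ℤ[G].Carrier degree) → (∀ j → β j ≈ b j •ℤ α′) →
    let I = ℤ[G].Ideal⟨ b ⟩ in
    (HasNormalIntegralBasis ⇔ ℤ[G].IsPrincipal I)
    × (∀ θ t → IsNormalIntegralBasisGenerator θ → θ ≈ t •ℤ α′ → I ≐ ℤ[G].R[G]· t)
    × (∀ t → I ≐ ℤ[G].R[G]· t → IsNormalIntegralBasisGenerator (t •ℤ α′))
theorem2p2 L g β β-basis α′ ℚ-spanning ℤ-spanning b β≈b•α′ =
  mk⇔ (λ (θ , θ-generates) →
        -- Integrality of θ provides the `t` on which part (1) depends.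
        let t , θ≈t•α′ = ℤ-spanning θ (proj₁ θ-generates)
        in t , part₁ t θ-generates θ≈t•α′)
      (λ (t , I≐⟨t⟩) → t •ℤ α′ , part₂ t I≐⟨t⟩) ,
  (λ θ → part₁) ,
  part₂
  where
  open AbelianNumberField L using (numberField)
  open GaloisModule numberField g using (_•ℤ_)
  open GaloisModuleProperties numberField g
  part₁ = generator⇒principal β-basis ℚ-spanning ℤ-spanning b β≈b•α′
  part₂ = principal⇒generator β-basis ℚ-spanning ℤ-spanning b β≈b•α′
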